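{- For every integer $k\geq 0$, every $(2k+1)$-strong tournament is $(k+2)^{*}$-weakly connected.
   Context: A tournament is a digraph in which each pair of distinct vertices is joined by exactly one arc. A digraph is $m$-strong if it has more than $m$ vertices and remains strongly connected after deleting any set of fewer than $m$ vertices (equivalently, for each ordered pair $x,y$ there are $m$ internally disjoint $(x,y)$-paths). For distinct vertices $u,v$ of a digraph $D$, a weak $k^{*}$-container between $u$ and $v$ is a set of $k$ internally disjoint paths, each of which is either a $(u,v)$-path or a $(v,u)$-path (different paths may have different directions), whose union contains every vertex of $D$. $D$ is $k^{*}$-weakly connected if there is a weak $k^{*}$-container between every two distinct vertices of $D$. -}

module Defs where

open import Data.Fin.Base using (Fin)
open import Data.Fin.Subset as Subset using (Subset; ∣_∣)
open import Data.List.Base using (List; []; _∷_; _++_)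
open import Data.List.Membership.Propositional using (_∈_)
open import Data.List.Relation.Binary.Disjoint.Propositional using (Disjoint)
open import Data.List.Relation.Unary.All using (All)
open import Data.List.Relation.Unary.Linked using (Linked)
open import Data.List.Relation.Unary.Unique.Propositional using (Unique)
open import Data.Nat.Base using (ℕ; _<_)
open import Data.Product.Base using (Σ-syntax; ∃-syntax; _×_)
open import Data.Sum.Base using (_⊎_; [_,_])
open import Function.Definitions using (Injective)
open import Level using (0ℓ)
open import Relation.Binary.Core using (Rel)
open import Relation.Binary.Definitions using (Decidable)
open import Relation.Binary.PropositionalEquality.Core using (_≡_; _≢_)
open import Relation.Nullary.Negation.Core using (¬_)

record Digraph (n : ℕ) : Set₁ where
  infix 4 _⟶_
  field
    _⟶_      : Rel (Fin n) 0ℓ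
    _⟶?_     : Decidable _⟶_
    loopless : ∀ x → ¬ (x ⟶ x)

module _ {n : ℕ} (D : Digraph n) where

  open Digraph D

  IsTournament : Set
  IsTournament = ∀ {x y} → x ≢ y → (x ⟶ y × ¬ (y ⟶ x)) ⊎ (y ⟶ x × ¬ (x ⟶ y))

  -- Uniqueness of the vertices forces x ≢ y, so an inhabitant is a directed
  -- path with distinct ends.
  record Path (x y : Fin n) : Set where
    field
      internal : List (Fin n)

    vertices : List (Fin n)
    vertices = x ∷ internal ++ y ∷ []

    field
      linked : Linked _⟶_ vertices
      unique : Unique vertices

  -- Strong connectedness of D − S: its vertices are those outside S, and its
  -- paths are the paths of D that avoid S.
  StronglyConnectedWithout : Subset n → Set
  StronglyConnectedWithout S =
    ∀ {x y} → x Subset.∉ S → y Subset.∉ S → x ≢ y →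
    Σ[ P ∈ Path x y ] All (Subset._∉ S) (Path.vertices P)

  Strong : ℕ → Set
  Strong m = m < n × (∀ (S : Subset n) → ∣ S ∣ < m → StronglyConnectedWithout S)

  PathBetween : Fin n → Fin n → Set
  PathBetween u v = Path u v ⊎ Path v u

  internalOf verticesOf : ∀ {u v} → PathBetween u v → List (Fin n)
  internalOf = [ Path.internal , Path.internal ]
  verticesOf = [ Path.vertices , Path.vertices ]

  record WeakContainer (k : ℕ) (u v : Fin n) : Set where
    field
      path     : Fin k → PathBetween u v
      -- A container is a set of k paths.  Disjointness alone would allow a
      -- single arc, which has no internal vertices, to be counted repeatedly.
      distinct : Injective _≡_ _≡_ (λ i → verticesOf (path i))
      disjoint : ∀ {i j} → i ≢ j → Disjoint (internalOf (path i)) (internalOf (path j))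
      spanning : ∀ w → ∃[ i ] w ∈ verticesOf (path i)

  WeaklyConnected* : ℕ → Set
  WeaklyConnected* k = ∀ {u v} → u ≢ v → WeakContainer k u v

{-# OPTIONS --safe #-}
module Submission where

-- Call a path between u and v short if it has one or two internal vertices.
-- Suppose u ⟶ v and at most 2k vertices other than u and v have been deleted.
-- A (v , u)-path survives.  If none of its vertices is the middle of a path of
-- length two between u and v, then it starts among the common out-neighbours
-- of u and v and ends among their common in-neighbours, so it contains an arc
-- x ⟶ y from the former to the latter, and u ⟶ x ⟶ y ⟶ v is a short path.
-- Greedily, this gives k internally disjoint short paths.  What remains after
-- deleting their internal vertices is a strong tournament, and a Hamiltonian
-- cycle of it (Camion) supplies the last two paths.  To lengthen a cycle C that
-- is not Hamiltonian, insert a vertex with arcs both from and to C, or, if there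
-- is none, insert an arc x ⟶ y with x dominated by C and y dominating C.

open import Defs
open import Data.Empty using (⊥-elim)
open import Data.Fin.Base using (Fin; zero; suc)
open import Data.Fin.Properties using (_≟_; any?; injective⇒≤)
open import Data.Fin.Subset as Subset using (Subset; ∣_∣; _∪_; ⁅_⁆; ⋃; inside; outside)
open import Data.Fin.Subset.Properties using (_∈?_; ∉⊥; ∣⊥∣≡0; ∣⁅x⁆∣≡1; x∈⁅x⁆; x∈⁅y⁆⇒x≡y; x∈p∪q⁺; x∈p∪q⁻)
open import Data.List.Base using (List; []; _∷_; _++_; [_]; length; lookup; map)
open import Data.List.Membership.DecPropositional using () renaming (_∈?_ to member?)
open import Data.List.Membership.Propositional using (_∈_; _∉_)
open import Data.List.Membership.Propositional.Properties using (∈-++⁺ˡ; ∈-++⁺ʳ; ∈-++⁻; ∈-∃++; ∈-lookup)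
open import Data.List.Properties using (∷-injective; ∷-injectiveˡ; ∷ʳ-injectiveˡ; ++-assoc)
open import Data.List.Relation.Binary.Disjoint.Propositional using (Disjoint)
open import Data.List.Relation.Binary.Permutation.Propositional using (_↭_; ↭-refl; ↭-sym; ↭-trans; prep; swap; ↭⇒↭ₛ)
open import Data.List.Relation.Binary.Permutation.Propositional.Properties using (All-resp-↭; ∈-resp-↭; ↭-length; shift; ∷↭∷ʳ)
open import Data.List.Relation.Binary.Permutation.Setoid.Properties using (Unique-resp-↭)
open import Data.List.Relation.Unary.All as All using (All; []; _∷_)
open import Data.List.Relation.Unary.All.Properties as All using (¬Any⇒All¬)
open import Data.List.Relation.Unary.AllPairs using ([]; _∷_)
open import Data.List.Relation.Unary.Any using (here; there)
open import Data.List.Relation.Unary.Linked using (Linked; [-]; _∷_)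
open import Data.List.Relation.Unary.Unique.Propositional using (Unique)
open import Data.Nat.Base using (ℕ; zero; suc; _+_; _*_; _≤_; _<_; z≤n; s≤s)
open import Data.Nat.Properties using (≤-refl; ≤-reflexive; ≤-trans; <⇒≤; m≤n⇒m≤1+n; m≤m+n; m≤n+m; +-suc; +-comm; +-mono-≤; +-monoʳ-≤; *-suc; 1+n≰n)
open import Data.Product.Base using (Σ-syntax; ∃-syntax; _×_; _,_; proj₁; proj₂)
open import Data.Sum.Base as Sum using (_⊎_; inj₁; inj₂)
open import Data.Vec.Base using ([]; _∷_)
open import Function.Base using (_∘_; id)
open import Relation.Binary.PropositionalEquality using (_≡_; _≢_; refl; sym; trans; cong; subst; ≢-sym; setoid)
open import Relation.Nullary.Decidable using (yes; no; ¬?; _×-dec_)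
open import Relation.Nullary.Negation using (¬_)

-- Sizes of vertex sets, and lists without repetition

∣p∪q∣≤∣p∣+∣q∣ : ∀ {n} (p q : Subset n) → ∣ p ∪ q ∣ ≤ ∣ p ∣ + ∣ q ∣
∣p∪q∣≤∣p∣+∣q∣ []            []            = z≤n
∣p∪q∣≤∣p∣+∣q∣ (inside  ∷ p) (inside  ∷ q) =
  s≤s (≤-trans (∣p∪q∣≤∣p∣+∣q∣ p q) (+-monoʳ-≤ ∣ p ∣ (m≤n+m ∣ q ∣ 1)))
∣p∪q∣≤∣p∣+∣q∣ (inside  ∷ p) (outside ∷ q) = s≤s (∣p∪q∣≤∣p∣+∣q∣ p q)
∣p∪q∣≤∣p∣+∣q∣ (outside ∷ p) (inside  ∷ q) =
  subst (suc ∣ p ∪ q ∣ ≤_) (sym (+-suc ∣ p ∣ ∣ q ∣)) (s≤s (∣p∪q∣≤∣p∣+∣q∣ p q))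
∣p∪q∣≤∣p∣+∣q∣ (outside ∷ p) (outside ∷ q) = ∣p∪q∣≤∣p∣+∣q∣ p q

fromList : ∀ {n} → List (Fin n) → Subset n
fromList xs = ⋃ (map ⁅_⁆ xs)

∣fromList∣≤length : ∀ {n} (xs : List (Fin n)) → ∣ fromList xs ∣ ≤ length xs
∣fromList∣≤length {n} [] = ≤-reflexive (∣⊥∣≡0 n)
∣fromList∣≤length (x ∷ xs) = ≤-trans (∣p∪q∣≤∣p∣+∣q∣ ⁅ x ⁆ (fromList xs))
  (+-mono-≤ (≤-reflexive (∣⁅x⁆∣≡1 x)) (∣fromList∣≤length xs))

∈-fromList⁺ : ∀ {n} {x : Fin n} {xs} → x ∈ xs → x Subset.∈ fromList xs
∈-fromList⁺ {xs = y ∷ ys} (here refl) = x∈p∪q⁺ (inj₁ (x∈⁅x⁆ y))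
∈-fromList⁺ {xs = y ∷ ys} (there x∈)  = x∈p∪q⁺ (inj₂ (∈-fromList⁺ x∈))

∈-fromList⁻ : ∀ {n} {x : Fin n} xs → x Subset.∈ fromList xs → x ∈ xs
∈-fromList⁻ []       x∈ = ⊥-elim (∉⊥ x∈)
∈-fromList⁻ (y ∷ ys) x∈ with x∈p∪q⁻ ⁅ y ⁆ (fromList ys) x∈
... | inj₁ x∈y  = here (x∈⁅y⁆⇒x≡y y x∈y)
... | inj₂ x∈ys = there (∈-fromList⁻ ys x∈ys)

module _ {A : Set} where

  lookup-injective : ∀ {xs : List A} → Unique xs → ∀ {i j} → lookup xs i ≡ lookup xs j → i ≡ j
  lookup-injective (_ ∷ _)  {zero}  {zero}  _  = refl
  lookup-injective (x∉ ∷ _) {zero}  {suc j} eq = ⊥-elim (All.lookup x∉ (∈-lookup j) eq)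
  lookup-injective (x∉ ∷ _) {suc i} {zero}  eq = ⊥-elim (All.lookup x∉ (∈-lookup i) (sym eq))
  lookup-injective (_ ∷ u)  {suc i} {suc j} eq = cong suc (lookup-injective u eq)

  Unique-++⁻ : ∀ (xs : List A) {ys} → Unique (xs ++ ys) → Unique xs × Unique ys × Disjoint xs ys
  Unique-++⁻ []       u = [] , u , λ ()
  Unique-++⁻ (x ∷ xs) (x∉ ∷ u) with Unique-++⁻ xs u
  ... | uxs , uys , disj = All.++⁻ˡ xs x∉ ∷ uxs , uys , λ where
    (here refl , z∈ys) → All.lookup (All.++⁻ʳ xs x∉) z∈ys refl
    (there z∈  , z∈ys) → disj (z∈ , z∈ys)

  Linked-split : ∀ {R : A → A → Set} xs {y zs} → Linked R (xs ++ y ∷ zs) → Linked R (xs ++ [ y ]) × Linked R (y ∷ zs)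
  Linked-split []           l       = [-] , l
  Linked-split (x ∷ [])     (r ∷ l) = r ∷ [-] , l
  Linked-split (x ∷ z ∷ xs) (r ∷ l) with Linked-split (z ∷ xs) l
  ... | l₁ , l₂ = r ∷ l₁ , l₂

  Unique-↭ : ∀ {xs ys : List A} → xs ↭ ys → Unique xs → Unique ys
  Unique-↭ p = Unique-resp-↭ (setoid A) (↭⇒↭ₛ p)

unique⇒length≤ : ∀ {n} {xs : List (Fin n)} → Unique xs → length xs ≤ n
unique⇒length≤ u = injective⇒≤ (lookup-injective u)

-- Paths between two vertices and families of disjoint paths

module _ {n : ℕ} (T : Digraph n) where

  open Digraph T

  ⟶⇒≢ : ∀ {x y} → x ⟶ y → x ≢ y
  ⟶⇒≢ x⟶x refl = loopless _ x⟶x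

  ⟶⇒≢′ : ∀ {x y} → x ⟶ y → y ≢ x
  ⟶⇒≢′ x⟶y = ≢-sym (⟶⇒≢ x⟶y)

  source∉internal : ∀ {x y} (P : Path T x y) → x ∉ Path.internal P
  source∉internal P x∈ with Path.unique P
  ... | x∉ ∷ _ = All.lookup x∉ (∈-++⁺ˡ x∈) refl

  target∉internal : ∀ {x y} (P : Path T x y) → y ∉ Path.internal P
  target∉internal P y∈ with Path.unique P
  ... | _ ∷ u = proj₂ (proj₂ (Unique-++⁻ (Path.internal P) u)) (y∈ , here refl)

  ends∉internalOf : ∀ {u v} (P : PathBetween T u v) → u ∉ internalOf T P × v ∉ internalOf T P
  ends∉internalOf (inj₁ P) = source∉internal P , target∉internal P
  ends∉internalOf (inj₂ P) = target∉internal P , source∉internal P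

  -- Paths of opposite directions already differ in their first vertex.
  verticesOf≡⇒internalOf≡ : ∀ {u v} → u ≢ v → (P Q : PathBetween T u v) →
    verticesOf T P ≡ verticesOf T Q → internalOf T P ≡ internalOf T Q
  verticesOf≡⇒internalOf≡ u≢v (inj₁ P) (inj₁ Q) eq = ∷ʳ-injectiveˡ _ _ (proj₂ (∷-injective eq))
  verticesOf≡⇒internalOf≡ u≢v (inj₂ P) (inj₂ Q) eq = ∷ʳ-injectiveˡ _ _ (proj₂ (∷-injective eq))
  verticesOf≡⇒internalOf≡ u≢v (inj₁ P) (inj₂ Q) eq = ⊥-elim (u≢v (∷-injectiveˡ eq))
  verticesOf≡⇒internalOf≡ u≢v (inj₂ P) (inj₁ Q) eq = ⊥-elim (u≢v (sym (∷-injectiveˡ eq)))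

  internalOf⊆verticesOf : ∀ {u v} (P : PathBetween T u v) {w} → w ∈ internalOf T P → w ∈ verticesOf T P
  internalOf⊆verticesOf (inj₁ P) w∈ = there (∈-++⁺ˡ w∈)
  internalOf⊆verticesOf (inj₂ P) w∈ = there (∈-++⁺ˡ w∈)

  swapPath : ∀ {u v} → PathBetween T u v → PathBetween T v u
  swapPath = Sum.swap

  verticesOf-swap : ∀ {u v} (P : PathBetween T u v) → verticesOf T (swapPath P) ≡ verticesOf T P
  verticesOf-swap (inj₁ P) = refl
  verticesOf-swap (inj₂ P) = refl

  internalOf-swap : ∀ {u v} (P : PathBetween T u v) → internalOf T (swapPath P) ≡ internalOf T P
  internalOf-swap (inj₁ P) = refl
  internalOf-swap (inj₂ P) = refl

  -- By this symmetry the theorem need only be proved for pairs with `u ⟶ v`.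
  swapContainer : ∀ {k u v} → WeakContainer T k u v → WeakContainer T k v u
  swapContainer C = record
    { path     = λ i → swapPath (path i)
    ; distinct = λ {i} {j} eq → distinct
        (trans (sym (verticesOf-swap (path i))) (trans eq (verticesOf-swap (path j))))
    ; disjoint = λ {i} {j} i≢j (p , q) → disjoint i≢j
        (subst (_ ∈_) (internalOf-swap (path i)) p , subst (_ ∈_) (internalOf-swap (path j)) q)
    ; spanning = λ w → let i , w∈ = spanning w in i , subst (w ∈_) (sym (verticesOf-swap (path i))) w∈
    }
    where open WeakContainer C

  -- A weak container without the spanning condition, so that it can be built one path at a time.
  record Packing (k : ℕ) (u v : Fin n) : Set where
    field
      path     : Fin k → PathBetween T u v
      distinct : ∀ {i j} → verticesOf T (path i) ≡ verticesOf T (path j) → i ≡ j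
      disjoint : ∀ {i j} → i ≢ j → Disjoint (internalOf T (path i)) (internalOf T (path j))

  addPath : ∀ {k u v} (F : Packing k u v) (Q : PathBetween T u v) →
    (∀ i → verticesOf T Q ≢ verticesOf T (Packing.path F i)) →
    (∀ i → Disjoint (internalOf T Q) (internalOf T (Packing.path F i))) →
    Packing (suc k) u v
  addPath {k} {u} {v} F Q Q≢ Q# = record
    { path     = path′
    ; distinct = λ {i} {j} → distinct′ i j
    ; disjoint = λ {i} {j} → disjoint′ i j
    }
    where
    open Packing F
    path′ : Fin (suc k) → PathBetween T u v
    path′ zero    = Q
    path′ (suc i) = path i
    distinct′ : ∀ i j → verticesOf T (path′ i) ≡ verticesOf T (path′ j) → i ≡ j
    distinct′ zero    zero    _  = refl
    distinct′ zero    (suc j) eq = ⊥-elim (Q≢ j eq)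
    distinct′ (suc i) zero    eq = ⊥-elim (Q≢ i (sym eq))
    distinct′ (suc i) (suc j) eq = cong suc (distinct eq)
    disjoint′ : ∀ i j → i ≢ j → Disjoint (internalOf T (path′ i)) (internalOf T (path′ j))
    disjoint′ zero    zero    i≢j _       = i≢j refl
    disjoint′ zero    (suc j) _   d       = Q# j d
    disjoint′ (suc i) zero    _   (p , q) = Q# i (q , p)
    disjoint′ (suc i) (suc j) i≢j d       = disjoint (i≢j ∘ cong suc) d

module _ {n : ℕ} (T : Digraph n) (tournament : IsTournament T) where

  open Digraph T

  arc : ∀ {x y} → x ≢ y → x ⟶ y ⊎ y ⟶ x
  arc x≢y = Sum.map proj₁ proj₁ (tournament x≢y)

  ⟶-asym : ∀ {x y} → x ⟶ y → ¬ (y ⟶ x)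
  ⟶-asym x⟶y y⟶x with tournament (⟶⇒≢ T x⟶y)
  ... | inj₁ (_ , ¬y⟶x) = ¬y⟶x y⟶x
  ... | inj₂ (_ , ¬x⟶y) = ¬x⟶y x⟶y

  -- Hamiltonian cycles of T − S

  -- Besides the ends, only the multiset of inner vertices is recorded: this suffices to carry over
  -- length, uniqueness and membership.
  Insertion : Fin n → Fin n → List (Fin n) → Fin n → Set
  Insertion w x L y = ∃[ L′ ] Linked _⟶_ (x ∷ L′ ++ [ y ]) × L′ ↭ w ∷ L

  insertLater : ∀ {w x b L y} → x ⟶ b → Insertion w b L y → Insertion w x (b ∷ L) y
  insertLater {w} {b = b} x⟶b (L′ , l , p) = b ∷ L′ , x⟶b ∷ l , ↭-trans (prep b p) (swap b w ↭-refl)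

  -- Scan forwards from `x ⟶ w`: the first vertex `b` of `L` with `w ⟶ b` has a predecessor with an
  -- arc to `w`, and `w` fits between the two.
  insert-or-dominated : ∀ {w} x L {y} → x ⟶ w → All (w ≢_) L → Linked _⟶_ (x ∷ L ++ [ y ]) →
    All (_⟶ w) (x ∷ L) ⊎ Insertion w x L y
  insert-or-dominated x [] x⟶w _ _ = inj₁ (x⟶w ∷ [])
  insert-or-dominated x (b ∷ L) x⟶w (w≢b ∷ w≢) (x⟶b ∷ l) with arc w≢b
  ... | inj₁ w⟶b = inj₂ (_ , x⟶w ∷ w⟶b ∷ l , ↭-refl)
  ... | inj₂ b⟶w = Sum.map (x⟶w ∷_) (insertLater x⟶b) (insert-or-dominated b L b⟶w w≢ l)

  -- The mirror image: scanning backwards from `w ⟶ y`, `w` fits right after the last vertex that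
  -- has an arc to it.
  insert-or-dominating : ∀ {w} x L {y} → w ⟶ y → All (w ≢_) (x ∷ L) → Linked _⟶_ (x ∷ L ++ [ y ]) →
    All (w ⟶_) (x ∷ L) ⊎ Insertion w x L y
  insert-or-dominating x [] w⟶y (w≢x ∷ []) _ with arc w≢x
  ... | inj₁ w⟶x = inj₁ (w⟶x ∷ [])
  ... | inj₂ x⟶w = inj₂ (_ , x⟶w ∷ w⟶y ∷ [-] , ↭-refl)
  insert-or-dominating x (b ∷ L) w⟶y (w≢x ∷ w≢) (x⟶b ∷ l) with insert-or-dominating b L w⟶y w≢ l
  ... | inj₂ ins = inj₂ (insertLater x⟶b ins)
  ... | inj₁ (w⟶b ∷ w⟶L) with arc w≢x
  ...   | inj₁ w⟶x = inj₁ (w⟶x ∷ w⟶b ∷ w⟶L)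
  ...   | inj₂ x⟶w = inj₂ (_ , x⟶w ∷ w⟶b ∷ l , ↭-refl)

  module _ (S : Subset n) (strong : StronglyConnectedWithout T S) where

    record Cycle (u : Fin n) : Set where
      field
        rest   : List (Fin n)
        linked : Linked _⟶_ (u ∷ rest ++ [ u ])
        unique : Unique (u ∷ rest)
        avoids : All (Subset._∉ S) (u ∷ rest)

    module _ {u : Fin n} (C : Cycle u) where

      open Cycle C

      -- The inclusion keeps `v` on the cycle while it grows, so that the final cycle can be cut
      -- there.
      Longer : Set
      Longer = Σ[ C′ ∈ Cycle u ] length rest < length (Cycle.rest C′) × (∀ {z} → z ∈ rest → z ∈ Cycle.rest C′)

      enlarge : ∀ m ms {L′} → Linked _⟶_ (u ∷ L′ ++ [ u ]) → L′ ↭ (m ∷ ms) ++ rest →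
        Unique ((m ∷ ms) ++ u ∷ rest) → All (Subset._∉ S) (m ∷ ms) → Longer
      enlarge m ms {L′} l p uniq avoid = record
        { rest = L′ ; linked = l ; unique = Unique-↭ q uniq
        ; avoids = All-resp-↭ q (All.++⁺ avoid avoids) } ,
        ≤-trans (s≤s (length-++ ms)) (≤-reflexive (sym (↭-length p))) ,
        λ z∈ → ∈-resp-↭ (↭-sym p) (∈-++⁺ʳ (m ∷ ms) z∈)
        where
        q : (m ∷ ms) ++ u ∷ rest ↭ u ∷ L′
        q = ↭-trans (shift u (m ∷ ms) rest) (prep u (↭-sym p))
        length-++ : ∀ xs → length rest ≤ length (xs ++ rest)
        length-++ []       = ≤-refl
        length-++ (_ ∷ xs) = m≤n⇒m≤1+n (length-++ xs)

      insert : ∀ {w} → w Subset.∉ S → All (w ≢_) (u ∷ rest) → Insertion w u rest u → Longer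
      insert w∉S w≢ (L′ , l , p) = enlarge _ [] l p (w≢ ∷ unique) (w∉S ∷ [])

      -- Any arc of the cycle could be replaced by a detour through `x ⟶ y`; here it is the arc
      -- leaving `u`, as `y` dominates whatever follows `u`.
      insertPair : ∀ {x y} → x Subset.∉ S → y Subset.∉ S → x ⟶ y →
        All (_⟶ x) (u ∷ rest) → All (y ⟶_) (u ∷ rest) → Longer
      insertPair {x} {y} x∉S y∉S x⟶y ⟶x@(u⟶x ∷ _) y⟶@(y⟶u ∷ y⟶rest) =
        enlarge x [ y ] (u⟶x ∷ x⟶y ∷ link rest y⟶rest linked) ↭-refl
          ((⟶⇒≢ T x⟶y ∷ All.map (⟶⇒≢′ T) ⟶x) ∷ All.map (⟶⇒≢ T) y⟶ ∷ unique) (x∉S ∷ y∉S ∷ [])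
        where
        link : ∀ L → All (y ⟶_) L → Linked _⟶_ (u ∷ L ++ [ u ]) → Linked _⟶_ (y ∷ L ++ [ u ])
        link []      _            _       = y⟶u ∷ [-]
        link (_ ∷ _) (y⟶z ∷ _) (_ ∷ l) = y⟶z ∷ l

      data Position (w : Fin n) : Set where
        on          : w ∈ u ∷ rest → Position w
        dominated   : All (_⟶ w) (u ∷ rest) → Position w
        dominating  : All (w ⟶_) (u ∷ rest) → Position w
        insertable  : Longer → Position w

      -- The cycle is listed from `u` back to `u`, so the arc between `w` and `u` can start a scan
      -- at either end: forwards if `u ⟶ w`, backwards if `w ⟶ u`.
      position : ∀ w → w Subset.∉ S → Position w
      position w w∉S with member? _≟_ w (u ∷ rest)
      ... | yes w∈ = on w∈
      ... | no w∉ with ¬Any⇒All¬ (u ∷ rest) w∉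
      ...   | w≢@(w≢u ∷ w≢rest) with arc w≢u
      ...     | inj₁ w⟶u = Sum.[ dominating , insertable ∘ insert w∉S w≢ ] (insert-or-dominating u rest w⟶u w≢ linked)
      ...     | inj₂ u⟶w = Sum.[ dominated , insertable ∘ insert w∉S w≢ ]
                  (insert-or-dominated u rest u⟶w w≢rest linked)

      -- While the current vertex is dominated by the cycle, no arc leads from it to the cycle.
      -- Since `z` is on the cycle or dominates it, the walk has to reach a dominating vertex, which
      -- gives the pair to insert, unless an insertable vertex comes first.
      walk-dominated : ∀ {x} ys {z} → All (_⟶ x) (u ∷ rest) → z ∈ u ∷ rest ⊎ All (z ⟶_) (u ∷ rest) →
        Linked _⟶_ (x ∷ ys ++ [ z ]) → All (Subset._∉ S) (x ∷ ys ++ [ z ]) → Longer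
      walk-dominated [] ⟶x (inj₁ z∈) (x⟶z ∷ _) _ = ⊥-elim (⟶-asym x⟶z (All.lookup ⟶x z∈))
      walk-dominated [] ⟶x (inj₂ z⟶) (x⟶z ∷ _) (x∉S ∷ z∉S ∷ []) = insertPair x∉S z∉S x⟶z ⟶x z⟶
      walk-dominated (y ∷ ys) ⟶x z (x⟶y ∷ l) (x∉S ∷ y∉S ∷ a) with position y y∉S
      ... | on y∈         = ⊥-elim (⟶-asym x⟶y (All.lookup ⟶x y∈))
      ... | dominated ⟶y  = walk-dominated ys ⟶y z l (y∉S ∷ a)
      ... | dominating y⟶ = insertPair x∉S y∉S x⟶y ⟶x y⟶
      ... | insertable C′ = C′

      -- From a vertex on the cycle no arc leads to a dominating one, so the walk towards `z` must
      -- first meet a dominated or an insertable vertex.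
      walk-on : ∀ {x} ys {z} → x ∈ u ∷ rest → All (z ⟶_) (u ∷ rest) →
        Linked _⟶_ (x ∷ ys ++ [ z ]) → All (Subset._∉ S) (x ∷ ys ++ [ z ]) → Longer
      walk-on [] x∈ z⟶ (x⟶z ∷ _) _ = ⊥-elim (⟶-asym x⟶z (All.lookup z⟶ x∈))
      walk-on (y ∷ ys) x∈ z⟶ (x⟶y ∷ l) (x∉S ∷ y∉S ∷ a) with position y y∉S
      ... | on y∈         = walk-on ys y∈ z⟶ l (y∉S ∷ a)
      ... | dominated ⟶y  = walk-dominated ys ⟶y (inj₂ z⟶) l (y∉S ∷ a)
      ... | dominating y⟶ = ⊥-elim (⟶-asym x⟶y (All.lookup y⟶ x∈))
      ... | insertable C′ = C′

      lengthen : ∀ {w} → w Subset.∉ S → w ∉ u ∷ rest → Longer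
      lengthen {w} w∉S w∉ with position w w∉S
      ... | on w∈         = ⊥-elim (w∉ w∈)
      ... | insertable C′ = C′
      -- Strong connectedness supplies a path in the difficult direction: from `w` to `u` if `w` is
      -- dominated, from `u` to `w` if it is dominating.
      ... | dominated ⟶w  = let P , a = strong w∉S (All.head avoids) (w∉ ∘ here) in
        walk-dominated (Path.internal P) ⟶w (inj₁ (here refl)) (Path.linked P) a
      ... | dominating w⟶ = let P , a = strong (All.head avoids) w∉S (w∉ ∘ here ∘ sym) in
        walk-on (Path.internal P) (here refl) w⟶ (Path.linked P) a

    Spanning : ∀ {u} → Cycle u → Set
    Spanning {u} C = ∀ w → w Subset.∈ S ⊎ w ∈ u ∷ Cycle.rest C

    hamiltonian : ∀ {u} fuel (C : Cycle u) → n ≤ fuel + length (Cycle.rest C) →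
      Σ[ C′ ∈ Cycle u ] Spanning C′ × (∀ {z} → z ∈ Cycle.rest C → z ∈ Cycle.rest C′)
    hamiltonian {u} fuel C bound
      with any? (λ w → ¬? (w ∈? S) ×-dec ¬? (member? _≟_ w (u ∷ Cycle.rest C)))
    hamiltonian {u} fuel C bound | no none = C , spanning , id
      where
      spanning : Spanning C
      spanning w with w ∈? S | member? _≟_ w (u ∷ Cycle.rest C)
      ... | yes w∈S | _      = inj₁ w∈S
      ... | no  _   | yes w∈ = inj₂ w∈
      ... | no w∉S  | no w∉  = ⊥-elim (none (w , w∉S , w∉))
    -- Without fuel `rest` has at least `n` entries, so `u` together with `rest` would give more
    -- than `n` distinct vertices.
    hamiltonian zero C bound | yes _ = ⊥-elim (1+n≰n (≤-trans (unique⇒length≤ (Cycle.unique C)) bound))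
    hamiltonian (suc fuel) C bound | yes (w , w∉S , w∉) with lengthen C w∉S w∉
    ... | C′ , longer , C⊆C′ with hamiltonian fuel C′
            (≤-trans bound (≤-trans (≤-reflexive (sym (+-suc fuel _))) (+-monoʳ-≤ fuel longer)))
    ...   | C″ , spanning , C′⊆C″ = C″ , spanning , C′⊆C″ ∘ C⊆C′

    cycleThroughArc : ∀ {u v} → u Subset.∉ S → v Subset.∉ S → u ⟶ v → Σ[ C ∈ Cycle u ] v ∈ Cycle.rest C
    cycleThroughArc {u} {v} u∉S v∉S u⟶v with strong v∉S u∉S (⟶⇒≢′ T u⟶v)
    ... | P , a = record
      { rest   = v ∷ Path.internal P
      ; linked = u⟶v ∷ Path.linked P
      ; unique = Unique-↭ rotate (Path.unique P)
      ; avoids = All-resp-↭ rotate a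
      } , here refl
      where
      rotate : Path.vertices P ↭ u ∷ v ∷ Path.internal P
      rotate = ↭-sym (∷↭∷ʳ u (v ∷ Path.internal P))

    -- A Hamiltonian cycle of `T − S`, listed from `u`, is cut at `v` into a path to `v` and a path
    -- back.
    spanningPair : ∀ {u v} → u Subset.∉ S → v Subset.∉ S → u ⟶ v →
      Σ[ P ∈ Path T u v ] Σ[ Q ∈ Path T v u ]
        All (Subset._∉ S) (Path.internal P) × All (Subset._∉ S) (Path.internal Q) ×
        Disjoint (Path.internal P) (Path.internal Q) ×
        (∀ w → w Subset.∈ S ⊎ w ∈ Path.vertices P ⊎ w ∈ Path.vertices Q)
    spanningPair {u} {v} u∉S v∉S u⟶v with cycleThroughArc u∉S v∉S u⟶v
    ... | C₀ , v∈ with hamiltonian n C₀ (m≤m+n n _)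
    ... | record { rest = L ; linked = l ; unique = uniq ; avoids = avoid } , spanning , C₀⊆ with ∈-∃++ (C₀⊆ v∈)
    ... | ys , zs , refl =
      record { internal = ys
             ; linked = proj₁ links
             ; unique = proj₁ (Unique-++⁻ (u ∷ ys ++ [ v ]) (subst Unique (cong (u ∷_) (sym (++-assoc ys [ v ] zs))) uniq)) } ,
      record { internal = zs
             ; linked = proj₂ links
             ; unique = proj₁ (proj₂ (Unique-++⁻ ys (Unique-↭ rotate uniq))) } ,
      All.++⁻ˡ ys (All.tail avoid) , All.tail (All.++⁻ʳ ys (All.tail avoid)) ,
      (λ (p , q) → proj₂ (proj₂ (Unique-++⁻ (u ∷ ys) uniq)) (there p , there q)) ,
      λ w → Sum.map₂ (locate w) (spanning w)
      where
      links : Linked _⟶_ (u ∷ ys ++ [ v ]) × Linked _⟶_ (v ∷ zs ++ [ u ])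
      links = Linked-split (u ∷ ys) (subst (Linked _⟶_) (cong (u ∷_) (++-assoc ys (v ∷ zs) [ u ])) l)
      rotate : u ∷ ys ++ v ∷ zs ↭ ys ++ v ∷ zs ++ [ u ]
      rotate = subst (u ∷ ys ++ v ∷ zs ↭_) (++-assoc ys (v ∷ zs) [ u ]) (∷↭∷ʳ u (ys ++ v ∷ zs))
      locate : ∀ w → w ∈ u ∷ ys ++ v ∷ zs → w ∈ u ∷ ys ++ [ v ] ⊎ w ∈ v ∷ zs ++ [ u ]
      locate w w∈ with ∈-++⁻ (u ∷ ys) w∈
      ... | inj₁ p = inj₁ (∈-++⁺ˡ p)
      ... | inj₂ p = inj₂ (∈-++⁺ˡ p)

  -- Short paths

  -- `nonempty` excludes the bare arc, so that disjoint short paths are distinct; `short` bounds the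
  -- number of vertices each path costs.
  record ShortPath (S : Subset n) (u v : Fin n) : Set where
    field
      path     : PathBetween T u v
      nonempty : internalOf T path ≢ []
      short    : length (internalOf T path) ≤ 2
      avoids   : All (Subset._∉ S) (internalOf T path)

  module _ {S : Subset n} {u v : Fin n} (u⟶v : u ⟶ v) where

    via : ∀ {x} → x Subset.∉ S → u ⟶ x → x ⟶ v → ShortPath S u v
    via {x} x∉S u⟶x x⟶v = record
      { path     = inj₁ record
        { internal = [ x ]
        ; linked   = u⟶x ∷ x⟶v ∷ [-]
        ; unique   = (⟶⇒≢ T u⟶x ∷ ⟶⇒≢ T u⟶v ∷ []) ∷ (⟶⇒≢ T x⟶v ∷ []) ∷ [] ∷ [] }
      ; nonempty = λ () ; short = s≤s z≤n ; avoids = x∉S ∷ [] }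

    viaBack : ∀ {x} → x Subset.∉ S → v ⟶ x → x ⟶ u → ShortPath S u v
    viaBack {x} x∉S v⟶x x⟶u = record
      { path     = inj₂ record
        { internal = [ x ]
        ; linked   = v⟶x ∷ x⟶u ∷ [-]
        ; unique   = (⟶⇒≢ T v⟶x ∷ ⟶⇒≢′ T u⟶v ∷ []) ∷ (⟶⇒≢ T x⟶u ∷ []) ∷ [] ∷ [] }
      ; nonempty = λ () ; short = s≤s z≤n ; avoids = x∉S ∷ [] }

    viaPair : ∀ {x y} → x Subset.∉ S → y Subset.∉ S →
      u ⟶ x → v ⟶ x → x ⟶ y → y ⟶ u → y ⟶ v → ShortPath S u v
    viaPair {x} {y} x∉S y∉S u⟶x v⟶x x⟶y y⟶u y⟶v = record
      { path     = inj₁ record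
        { internal = x ∷ y ∷ []
        ; linked   = u⟶x ∷ x⟶y ∷ y⟶v ∷ [-]
        -- The arcs `y ⟶ u` and `v ⟶ x` are what separates `y` from `u` and `x` from `v`.
        ; unique   = (⟶⇒≢ T u⟶x ∷ ⟶⇒≢′ T y⟶u ∷ ⟶⇒≢ T u⟶v ∷ [])
                   ∷ (⟶⇒≢ T x⟶y ∷ ⟶⇒≢′ T v⟶x ∷ []) ∷ (⟶⇒≢ T y⟶v ∷ []) ∷ [] ∷ [] }
      ; nonempty = λ () ; short = s≤s (s≤s z≤n) ; avoids = x∉S ∷ y∉S ∷ [] }

    -- The current vertex `x` is a common out-neighbour of `u` and `v`, so the walk cannot end with
    -- an arc to `u`. The first vertex that is not a common out-neighbour gives a path with one
    -- internal vertex or, as a common in-neighbour, one with two.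
    walk-out : ∀ {x} ys → u ⟶ x → v ⟶ x → Linked _⟶_ (x ∷ ys ++ [ u ]) →
      All (Subset._∉ S) (x ∷ ys) → All (u ≢_) ys → All (v ≢_) ys → ShortPath S u v
    walk-out [] u⟶x _ (x⟶u ∷ _) _ _ _ = ⊥-elim (⟶-asym u⟶x x⟶u)
    walk-out (y ∷ ys) u⟶x v⟶x (x⟶y ∷ l) (x∉S ∷ y∉S ∷ a) (u≢y ∷ u≢) (v≢y ∷ v≢) with arc u≢y | arc v≢y
    ... | inj₁ u⟶y | inj₁ v⟶y = walk-out ys u⟶y v⟶y l (y∉S ∷ a) u≢ v≢
    ... | inj₁ u⟶y | inj₂ y⟶v = via y∉S u⟶y y⟶v
    ... | inj₂ y⟶u | inj₁ v⟶y = viaBack y∉S v⟶y y⟶u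
    ... | inj₂ y⟶u | inj₂ y⟶v = viaPair x∉S y∉S u⟶x v⟶x x⟶y y⟶u y⟶v

    shortPath : StronglyConnectedWithout T S → u Subset.∉ S → v Subset.∉ S → ShortPath S u v
    shortPath strong u∉S v∉S with strong v∉S u∉S (⟶⇒≢′ T u⟶v)
    ... | P , _ ∷ a = start (Path.internal P) (Path.linked P) (All.++⁻ˡ _ a)
            (¬Any⇒All¬ _ (target∉internal T P)) (¬Any⇒All¬ _ (source∉internal T P))
      where
      start : ∀ ys → Linked _⟶_ (v ∷ ys ++ [ u ]) → All (Subset._∉ S) ys →
        All (u ≢_) ys → All (v ≢_) ys → ShortPath S u v
      -- A path from `v` to `u` runs against the arc `u ⟶ v`, so it has an internal vertex.
      start [] (v⟶u ∷ _) _ _ _ = ⊥-elim (⟶-asym u⟶v v⟶u)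
      start (y ∷ ys) (v⟶y ∷ l) (y∉S ∷ a) (u≢y ∷ u≢) (_ ∷ v≢) with arc u≢y
      ... | inj₁ u⟶y = walk-out ys u⟶y v⟶y l (y∉S ∷ a) u≢ v≢
      ... | inj₂ y⟶u = viaBack y∉S v⟶y y⟶u

  -- Packings of short paths and their completion to containers

  record ShortPacking (i : ℕ) (u v : Fin n) : Set where
    field
      packing  : Packing T i u v
      used     : Subset n
    open Packing packing public
    field
      small    : ∣ used ∣ ≤ 2 * i
      u∉used   : u Subset.∉ used
      v∉used   : v Subset.∉ used
      nonempty : ∀ j → internalOf T (path j) ≢ []
      -- Together these two make `used` exactly the set of internal vertices: the first yields
      -- disjointness from later paths, the second the spanning property.
      used⁺    : ∀ j {w} → w ∈ internalOf T (path j) → w Subset.∈ used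
      used⁻    : ∀ {w} → w Subset.∈ used → ∃[ j ] w ∈ internalOf T (path j)

  -- Equal vertex lists would have equal internal lists, and a list disjoint from itself is empty.
  disjoint⇒verticesOf≢ : ∀ {u v} → u ≢ v → (P Q : PathBetween T u v) → internalOf T Q ≢ [] →
    Disjoint (internalOf T P) (internalOf T Q) → verticesOf T P ≢ verticesOf T Q
  disjoint⇒verticesOf≢ u≢v P Q Q≢[] P#Q eq
    with internalOf T P | internalOf T Q | verticesOf≡⇒internalOf≡ T u≢v P Q eq
  ... | []     | .[]       | refl = Q≢[] refl
  ... | x ∷ xs | .(x ∷ xs) | refl = P#Q (here refl , here refl)

  addShortPath : ∀ {i u v} → u ≢ v → (F : ShortPacking i u v) → ShortPath (ShortPacking.used F) u v →
    ShortPacking (suc i) u v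
  addShortPath {i} {u} {v} u≢v F Q = record
    { packing  = addPath T packing Q.path
        (λ j → disjoint⇒verticesOf≢ u≢v Q.path (path j) (nonempty j) (Q# j)) Q#
    ; used     = used ∪ fromList qs
    ; small    = ≤-trans (∣p∪q∣≤∣p∣+∣q∣ used (fromList qs))
        (≤-trans (+-mono-≤ small (≤-trans (∣fromList∣≤length qs) Q.short))
          (≤-reflexive (trans (+-comm (2 * i) 2) (sym (*-suc 2 i)))))
    ; u∉used   = Sum.[ u∉used , proj₁ (ends∉internalOf T Q.path) ∘ ∈-fromList⁻ qs ] ∘ x∈p∪q⁻ used (fromList qs)
    ; v∉used   = Sum.[ v∉used , proj₂ (ends∉internalOf T Q.path) ∘ ∈-fromList⁻ qs ] ∘ x∈p∪q⁻ used (fromList qs)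
    ; nonempty = λ { zero → Q.nonempty ; (suc j) → nonempty j }
    ; used⁺    = λ { zero w∈ → x∈p∪q⁺ (inj₂ (∈-fromList⁺ w∈)) ; (suc j) w∈ → x∈p∪q⁺ (inj₁ (used⁺ j w∈)) }
    ; used⁻    = λ w∈ → Sum.[ (λ p → let j , q = used⁻ p in suc j , q) , (λ p → zero , ∈-fromList⁻ qs p) ]
        (x∈p∪q⁻ used (fromList qs) w∈)
    }
    where
    open ShortPacking F
    module Q = ShortPath Q
    qs = internalOf T Q.path
    Q# : ∀ j → Disjoint qs (internalOf T (path j))
    Q# j (p , q) = All.lookup Q.avoids p (used⁺ j q)

  -- When a path is added, at most `2 * i` vertices, fewer than `m`, have been deleted, so strong
  -- connectedness still applies.
  shortPacking : ∀ {m u v} → Strong T m → u ⟶ v → ∀ i → 2 * i ≤ m → ShortPacking i u v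
  shortPacking str u⟶v zero _ = record
    { packing  = record { path = λ () ; distinct = λ { {()} } ; disjoint = λ { {()} } }
    ; used     = Subset.⊥
    ; small    = ≤-reflexive (∣⊥∣≡0 n)
    ; u∉used   = ∉⊥
    ; v∉used   = ∉⊥
    ; nonempty = λ ()
    ; used⁺    = λ ()
    ; used⁻    = λ w∈ → ⊥-elim (∉⊥ w∈) }
  shortPacking {m} str u⟶v (suc i) 2+2i≤m = addShortPath (⟶⇒≢ T u⟶v) F
    (shortPath u⟶v (proj₂ str used (≤-trans (s≤s small) 2i<m)) u∉used v∉used)
    where
    2i<m : 2 * i < m
    2i<m = ≤-trans (m≤n+m _ 1) (subst (_≤ m) (*-suc 2 i) 2+2i≤m)
    F = shortPacking str u⟶v i (<⇒≤ 2i<m)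
    open ShortPacking F

  -- Vertices in `used` lie on the short paths and all others on the Hamiltonian cycle of
  -- `T − used`, whose two halves avoid the short paths internally.
  completeByCycle : ∀ {k u v} (F : ShortPacking k u v) →
    StronglyConnectedWithout T (ShortPacking.used F) → u ⟶ v → WeakContainer T (2 + k) u v
  completeByCycle {k} {u} {v} F strong u⟶v with spanningPair used strong u∉used v∉used u⟶v
    where open ShortPacking F
  ... | P , Q , P∉ , Q∉ , P#Q , spanning = record
    { path     = Packing.path F₂
    ; distinct = Packing.distinct F₂
    ; disjoint = Packing.disjoint F₂
    ; spanning = λ w → locate (spanning w)
    }
    where
    open ShortPacking F
    avoiding : ∀ {xs} → All (Subset._∉ used) xs → ∀ j → Disjoint xs (internalOf T (path j))
    avoiding a j (p , q) = All.lookup a p (used⁺ j q)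
    new : ∀ R → All (Subset._∉ used) (internalOf T R) → ∀ j → verticesOf T R ≢ verticesOf T (path j)
    new R a j = disjoint⇒verticesOf≢ (⟶⇒≢ T u⟶v) R (path j) (nonempty j) (avoiding a j)
    F₁ : Packing T (suc k) u v
    F₁ = addPath T packing (inj₁ P) (new (inj₁ P) P∉) (avoiding P∉)
    F₂ : Packing T (2 + k) u v
    F₂ = addPath T F₁ (inj₂ Q)
      -- `P` may be the bare arc, so `P` and `Q` are told apart by their first vertices.
      (λ { zero eq → ⟶⇒≢ T u⟶v (sym (∷-injectiveˡ eq)) ; (suc j) → new (inj₂ Q) Q∉ j })
      (λ { zero (q , p) → P#Q (p , q) ; (suc j) → avoiding Q∉ j })
    locate : ∀ {w} → w Subset.∈ used ⊎ w ∈ Path.vertices P ⊎ w ∈ Path.vertices Q →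
      ∃[ i ] w ∈ verticesOf T (Packing.path F₂ i)
    locate (inj₁ w∈)        = let j , p = used⁻ w∈ in suc (suc j) , internalOf⊆verticesOf T (path j) p
    locate (inj₂ (inj₁ w∈)) = suc zero , w∈
    locate (inj₂ (inj₂ w∈)) = zero , w∈

  containerAlongArc : ∀ k {u v} → Strong T (2 * k + 1) → u ⟶ v → WeakContainer T (2 + k) u v
  containerAlongArc k str u⟶v = completeByCycle F
    -- The `k` short paths use at most `2 * k` vertices, one below the strength `2 * k + 1`, which
    -- leaves room for the cycle.
    (proj₂ str used (≤-trans (s≤s small) (≤-reflexive (+-comm 1 (2 * k))))) u⟶v
    where
    F = shortPacking str u⟶v k (m≤m+n (2 * k) 1)
    open ShortPacking F

theorem2p7 : ∀ (k : ℕ) {n : ℕ} (T : Digraph n) → IsTournament T → Strong T (2 * k + 1) → WeaklyConnected* T (k + 2)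
theorem2p7 k T tournament strong {u} {v} u≢v = subst (λ m → WeakContainer T m u v) (+-comm 2 k)
  (Sum.[ containerAlongArc T tournament k strong
       , swapContainer T ∘ containerAlongArc T tournament k strong ] (arc T tournament u≢v))
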